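{- The minimum number of monochromatic triangles in a line $2$-coloring of the Desargues configuration, taken over all line $2$-colorings, is $0$.
   Context: A configuration is a pair $(\mathcal{P},\mathcal{L})$ with $\mathcal{P}$ a finite set of points and $\mathcal{L}$ a finite set of subsets of $\mathcal{P}$ called lines, such that any two distinct points lie together on at most one line, all points are on the same number of lines, all lines contain the same number of points, and there are at least three points. Three points $p_1,p_2,p_3$ form a triangle if there are lines $l_1,l_2,l_3$ with $p_1,p_2\in l_1$, $p_3\notin l_1$; $p_2,p_3\in l_2$, $p_1\notin l_2$; $p_1,p_3\in l_3$, $p_2\notin l_3$. The lines $l_1,l_2,l_3$ are then uniquely determined by the points. A line $2$-coloring assigns to each line one of the colors red, blue. A triangle is monochromatic if its lines $l_1,l_2,l_3$ all have the same color. The Desargues configuration is the $10_3$ configuration whose points are the $2$-element subsets of $\{1,2,3,4,5\}$ and whose lines correspond to the $3$-element subsets $T$ of $\{1,2,3,4,5\}$, the line of $T$ consisting of the three $2$-element subsets of $T$. -}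

module Defs where

open import Data.Fin.Subset using (Subset; inside; outside; ∣_∣; _⊆_)
open import Data.Fin.Subset.Properties using (_⊆?_)
open import Data.Bool.Properties using () renaming (_≟_ to _≟ᵇ_)
open import Data.List.Base using (List; []; _∷_; _++_; map; filter; length)
open import Data.List.Membership.Propositional using (lose) renaming (_∈_ to _∈ᴸ_)
open import Data.List.Membership.Propositional.Properties using (∈-map⁺; ∈-++⁺ˡ; ∈-++⁺ʳ)
open import Data.List.Relation.Unary.All using (all?; lookup; universal)
open import Data.List.Relation.Unary.Any using (any?; satisfied; here)
open import Data.List.Relation.Unary.Enumerates.Setoid using (IsEnumeration)
open import Data.List.Relation.Unary.Unique.Propositional using (Unique)
import Data.List.Relation.Unary.Unique.DecPropositional as DecUnique
open import Data.Nat.Base using (ℕ; zero; suc; _≤_)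
open import Data.Nat.Properties using (_≟_; _≤?_; ≡-irrelevant)
open import Data.Product.Base using (Σ; ∃; _×_; _,_)
open import Data.Product.Properties using () renaming (≡-dec to Σ-≡-dec)
open import Data.Vec.Base using ([]; _∷_)
open import Data.Vec.Properties using () renaming (≡-dec to Vec-≡-dec)
open import Relation.Binary.Definitions using (Decidable; DecidableEquality)
open import Relation.Binary.PropositionalEquality
  using (_≡_; _≢_; refl; sym; trans; cong; setoid)
open import Relation.Nullary.Decidable
  using (Dec; yes; no; map′; _×-dec_; _→-dec_; ¬?; from-yes)
open import Relation.Nullary.Negation using (¬_)
open import Relation.Unary using () renaming (Decidable to Decidable₁)

record FiniteSet : Set₁ where
  field
    Carrier  : Set
    elements : List Carrier
    unique   : Unique elements
    complete : IsEnumeration (setoid Carrier) elements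

  count : {P : Carrier → Set} → Decidable₁ P → ℕ
  count P? = length (filter P? elements)

  ∃? : {P : Carrier → Set} → Decidable₁ P → Dec (∃ P)
  ∃? P? = map′ satisfied (λ (x , px) → lose (complete x) px) (any? P? elements)

  ∀? : {P : Carrier → Set} → Decidable₁ P → Dec (∀ x → P x)
  ∀? P? = map′ (λ all x → lookup all (complete x)) (λ f → universal f elements) (all? P? elements)

-- Lines are abstract objects rather than subsets of Point; `extensional`
-- makes a line the same thing as its set of points.
record Configuration : Set₁ where
  field
    points lines : FiniteSet

  open FiniteSet points public using () renaming (Carrier to Point)
  open FiniteSet lines  public using () renaming (Carrier to Line)

  infix 4 _∈_ _∉_ _∈?_
  field
    _∈_  : Point → Line → Set
    _∈?_ : Decidable _∈_

  _∉_ : Point → Line → Set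
  p ∉ l = ¬ (p ∈ l)

  degree : Point → ℕ
  degree p = FiniteSet.count lines (λ l → p ∈? l)

  size : Line → ℕ
  size l = FiniteSet.count points (λ p → p ∈? l)

  field
    extensional : ∀ l m → (∀ p → p ∈ l → p ∈ m) → (∀ p → p ∈ m → p ∈ l) → l ≡ m
    linear      : ∀ p q → p ≢ q → ∀ l m → p ∈ l → q ∈ l → p ∈ m → q ∈ m → l ≡ m
    regular     : ∀ p q → degree p ≡ degree q
    uniform     : ∀ l m → size l ≡ size m
    ≥3-points   : 3 ≤ length (FiniteSet.elements points)

data Colour : Set where
  red blue : Colour

_≟ᶜ_ : DecidableEquality Colour
red  ≟ᶜ red  = yes refl
red  ≟ᶜ blue = no λ ()
blue ≟ᶜ red  = no λ ()
blue ≟ᶜ blue = yes refl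

pairs : {A : Set} → List A → List (A × A)
pairs []       = []
pairs (x ∷ xs) = map (x ,_) xs ++ pairs xs

-- Every 3-element subset of a duplicate-free list, listed exactly once
-- (in the order of the list).
triples : {A : Set} → List A → List (A × A × A)
triples []       = []
triples (x ∷ xs) = map (x ,_) (pairs xs) ++ triples xs

module _ (C : Configuration) where
  open Configuration C

  LineColouring : Set
  LineColouring = Line → Colour

  record Triangle (p₁ p₂ p₃ : Point) : Set where
    constructor triangle
    field
      l₁ l₂ l₃ : Line
      side₁ : p₁ ∈ l₁ × p₂ ∈ l₁ × p₃ ∉ l₁
      side₂ : p₂ ∈ l₂ × p₃ ∈ l₂ × p₁ ∉ l₂
      side₃ : p₁ ∈ l₃ × p₃ ∈ l₃ × p₂ ∉ l₃

  Monochromatic : LineColouring → ∀ {p₁ p₂ p₃} → Triangle p₁ p₂ p₃ → Set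
  Monochromatic c t = c l₁ ≡ c l₂ × c l₂ ≡ c l₃
    where open Triangle t

  -- The sides of a triangle are determined by its vertices, so counting
  -- vertex sets is counting triangles.
  MonochromaticTriangle : LineColouring → Point × Point × Point → Set
  MonochromaticTriangle c (p₁ , p₂ , p₃) =
    Σ (Triangle p₁ p₂ p₃) (Monochromatic c)

  monochromaticTriangle? : ∀ c → Decidable₁ (MonochromaticTriangle c)
  monochromaticTriangle? c (p₁ , p₂ , p₃) =
    map′ (λ (l₁ , s₁ , l₂ , s₂ , c₁₂ , l₃ , s₃ , c₂₃) →
            triangle l₁ l₂ l₃ s₁ s₂ s₃ , c₁₂ , c₂₃)
         (λ (triangle l₁ l₂ l₃ s₁ s₂ s₃ , c₁₂ , c₂₃) →
            l₁ , s₁ , l₂ , s₂ , c₁₂ , l₃ , s₃ , c₂₃)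
         (∃? λ l₁ → side? p₁ p₂ p₃ l₁ ×-dec
          ∃? λ l₂ → side? p₂ p₃ p₁ l₂ ×-dec (c l₁ ≟ᶜ c l₂) ×-dec
          ∃? λ l₃ → side? p₁ p₃ p₂ l₃ ×-dec (c l₂ ≟ᶜ c l₃))
    where
    open FiniteSet lines using (∃?)

    side? : ∀ p q r l → Dec (p ∈ l × q ∈ l × r ∉ l)
    side? p q r l = (p ∈? l) ×-dec (q ∈? l) ×-dec ¬? (r ∈? l)

  #monochromaticTriangles : LineColouring → ℕ
  #monochromaticTriangles c =
    length (filter (monochromaticTriangle? c) (triples (FiniteSet.elements points)))

IsMinimumOf : {A : Set} → (A → ℕ) → ℕ → Set
IsMinimumOf f m = (∃ λ x → f x ≡ m) × (∀ x → m ≤ f x)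

SubsetOfSize : ℕ → ℕ → Set
SubsetOfSize n k = ∃ λ (S : Subset n) → ∣ S ∣ ≡ k

_≟ˢ_ : ∀ {n k} → DecidableEquality (SubsetOfSize n k)
_≟ˢ_ = Σ-≡-dec (Vec-≡-dec _≟ᵇ_) (λ e e′ → yes (≡-irrelevant e e′))

addIn : ∀ {n k} → SubsetOfSize n k → SubsetOfSize (suc n) (suc k)
addIn (S , e) = inside ∷ S , cong suc e

addOut : ∀ {n k} → SubsetOfSize n k → SubsetOfSize (suc n) k
addOut (S , e) = outside ∷ S , e

subsetsOfSize : ∀ n k → List (SubsetOfSize n k)
subsetsOfSize zero    zero    = ([] , refl) ∷ []
subsetsOfSize zero    (suc k) = []
subsetsOfSize (suc n) zero    = map addOut (subsetsOfSize n zero)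
subsetsOfSize (suc n) (suc k) =
  map addIn (subsetsOfSize n k) ++ map addOut (subsetsOfSize n (suc k))

subsetsOfSize-complete : ∀ {n k} (S : SubsetOfSize n k) → S ∈ᴸ subsetsOfSize n k
subsetsOfSize-complete {zero}  {zero}  ([] , refl) = here refl
subsetsOfSize-complete {suc n} {zero}  (outside ∷ S , e) =
  ∈-map⁺ addOut (subsetsOfSize-complete (S , e))
subsetsOfSize-complete {suc n} {suc k} (outside ∷ S , e) =
  ∈-++⁺ʳ (map addIn (subsetsOfSize n k)) (∈-map⁺ addOut (subsetsOfSize-complete (S , e)))
subsetsOfSize-complete {suc n} {suc k} (inside ∷ S , refl) =
  ∈-++⁺ˡ (∈-map⁺ addIn (subsetsOfSize-complete (S , refl)))

desarguesPoints : FiniteSet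
desarguesPoints = record
  { Carrier  = SubsetOfSize 5 2
  ; elements = subsetsOfSize 5 2
  ; unique   = from-yes (DecUnique.unique? _≟ˢ_ (subsetsOfSize 5 2))
  ; complete = subsetsOfSize-complete
  }

desarguesLines : FiniteSet
desarguesLines = record
  { Carrier  = SubsetOfSize 5 3
  ; elements = subsetsOfSize 5 3
  ; unique   = from-yes (DecUnique.unique? _≟ˢ_ (subsetsOfSize 5 3))
  ; complete = subsetsOfSize-complete
  }

_∈ᴰ_ : SubsetOfSize 5 2 → SubsetOfSize 5 3 → Set
(S , _) ∈ᴰ (T , _) = S ⊆ T

_∈ᴰ?_ : Decidable _∈ᴰ_
(S , _) ∈ᴰ? (T , _) = S ⊆? T

private
  module P = FiniteSet desarguesPoints
  module L = FiniteSet desarguesLines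

desargues-degree : ∀ p → L.count (λ l → p ∈ᴰ? l) ≡ 3
desargues-degree = from-yes (P.∀? λ p → L.count (λ l → p ∈ᴰ? l) ≟ 3)

desargues-size : ∀ l → P.count (λ p → p ∈ᴰ? l) ≡ 3
desargues-size = from-yes (L.∀? λ l → P.count (λ p → p ∈ᴰ? l) ≟ 3)

desargues : Configuration
desargues = record
  { points      = desarguesPoints
  ; lines       = desarguesLines
  ; _∈_         = _∈ᴰ_
  ; _∈?_        = _∈ᴰ?_
  ; extensional = from-yes (L.∀? λ l → L.∀? λ m →
      P.∀? (λ p → (p ∈ᴰ? l) →-dec (p ∈ᴰ? m)) →-dec
      (P.∀? (λ p → (p ∈ᴰ? m) →-dec (p ∈ᴰ? l)) →-dec (l ≟ˢ m)))
  ; linear      = from-yes (P.∀? λ p → P.∀? λ q → ¬? (p ≟ˢ q) →-dec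
      L.∀? λ l → L.∀? λ m →
      (p ∈ᴰ? l) →-dec ((q ∈ᴰ? l) →-dec ((p ∈ᴰ? m) →-dec ((q ∈ᴰ? m) →-dec (l ≟ˢ m)))))
  ; regular     = λ p q → trans (desargues-degree p) (sym (desargues-degree q))
  ; uniform     = λ l m → trans (desargues-size l) (sym (desargues-size m))
  ; ≥3-points   = from-yes (3 ≤? length P.elements)
  }

desargues-#points : length P.elements ≡ 10
desargues-#points = refl

desargues-#lines : length L.elements ≡ 10
desargues-#lines = refl

{-# OPTIONS --safe #-}
module Submission where

open import Defs
open import Data.Fin.Subset using (inside; outside)
open import Data.Nat.Base using (z≤n)
open import Data.Product.Base using (_,_)
open import Data.Vec.Base using ([]; _∷_)
open import Relation.Binary.PropositionalEquality using (refl)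

-- Sending a line T to the complement of T makes the lines the edges of K₅.
-- Two lines meet iff their edges share a vertex, and three pairwise meeting
-- lines are concurrent iff their edges form a triangle of K₅; so the sides of a
-- triangle of the configuration are three edges at a common vertex.  Splitting
-- K₅ into two 5-cycles leaves only two edges of each colour at every vertex.

-- The red lines are the cyclic intervals of length 3, the complements of the
-- edges of the cycle 1 2 3 4 5.
pentagonColouring : LineColouring desargues
pentagonColouring (inside  ∷ inside  ∷ inside  ∷ outside ∷ outside ∷ [] , _) = red
pentagonColouring (outside ∷ inside  ∷ inside  ∷ inside  ∷ outside ∷ [] , _) = red
pentagonColouring (outside ∷ outside ∷ inside  ∷ inside  ∷ inside  ∷ [] , _) = red
pentagonColouring (inside  ∷ outside ∷ outside ∷ inside  ∷ inside  ∷ [] , _) = red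
pentagonColouring (inside  ∷ inside  ∷ outside ∷ outside ∷ inside  ∷ [] , _) = red
-- The five remaining lines are the complements of the edges of the pentagram 1 3 5 2 4, the other
-- 5-cycle of K₅.
pentagonColouring _ = blue

theorem4p6 : IsMinimumOf (#monochromaticTriangles desargues) 0
-- `refl` checks the count by evaluation: the decision procedure rejects each of the 120 three-point
-- sets. Minimality is immediate, since a count is a natural number.
theorem4p6 = (pentagonColouring , refl) , λ _ → z≤n
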